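{- For all $s\in\mathbb{N}$ there exists $\eta\in\mathbb{N}$ such that every graph with no odd $K_{s+1}$-minor is $(8s-4)$-colorable with clustering $\eta$.
   Context: $\mathbb{N}=\{1,2,\dots\}$. Graphs are finite and may have loops and parallel edges. For a graph $H$, an $H$-minor of a graph $G$ is a map $\alpha$ with domain $V(H)\cup E(H)$ such that: for every $h\in V(H)$, $\alpha(h)$ is a nonempty connected subgraph of $G$; if $h_1\neq h_2$ are vertices of $H$ then $\alpha(h_1)$ and $\alpha(h_2)$ are disjoint; for each edge $e=h_1h_2$ of $H$, $\alpha(e)$ is an edge of $G$ with one end in $\alpha(h_1)$ and one end in $\alpha(h_2)$, and if $h_1=h_2$ then $\alpha(e)\in E(G)-E(\alpha(h_1))$; and $\alpha(e_1)\neq\alpha(e_2)$ for distinct edges $e_1,e_2$ of $H$. The $H$-minor $\alpha$ is odd if there is a 2-coloring $c$ of the vertices of $\bigcup_{h\in V(H)}\alpha(h)$ such that for every $h \in V(H)$ the restriction of $c$ to $\alpha(h)$ is a proper 2-coloring of $\alpha(h)$, and for every edge $e$ of $H$ the two ends of $\alpha(e)$ receive the same color in $c$. A coloring of a graph $G$ is any function assigning one color to each vertex of $G$ (not necessarily proper). A monochromatic component is a connected component of the subgraph of $G$ induced by all the vertices assigned a single color. A coloring has clustering $\eta$ if every monochromatic component has at most $\eta$ vertices. $G$ is $k$-colorable with clustering $\eta$ if $G$ has a coloring with at most $k$ colors and clustering $\eta$. -}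

module Defs where

open import Data.Bool.Base using (Bool; true; _∧_)
open import Data.Fin.Base using (Fin)
open import Data.Fin.Properties using (_≟_; _<?_)
open import Data.Fin.Subset using (Subset; _∈_; _∉_; _⊆_; ∣_∣; Nonempty)
open import Data.List.Base using (List; length; lookup; filter; allFin; cartesianProduct)
open import Data.Nat.Base using (ℕ; _≤_)
open import Data.Product.Base using (∃; ∃₂; _×_; _,_; proj₁; proj₂)
open import Data.Sum.Base using (_⊎_)
open import Data.Vec.Base using (tabulate)
import Data.Vec.Base as Vec
open import Data.Vec.Properties using (lookup∘tabulate; []=⇒lookup; lookup⇒[]=)
open import Function.Definitions using (Injective)
open import Relation.Binary.Construct.Closure.ReflexiveTransitive using (Star)
open import Relation.Binary.PropositionalEquality using (_≡_; _≢_; refl; sym; trans)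
open import Relation.Nullary.Decidable using (does)

-- Undirected: the order of the two ends of an edge carries no meaning, and
-- every later notion accesses it through the symmetric relation Joins.
-- Loops (equal ends) and parallel edges (equal values of ends) are allowed.
record Graph : Set where
  field
    order : ℕ
    size  : ℕ
    ends  : Fin size → Fin order × Fin order

open Graph public

V : Graph → Set
V G = Fin (order G)

E : Graph → Set
E G = Fin (size G)

Joins : (G : Graph) → E G → V G → V G → Set
Joins G e u v = ends G e ≡ (u , v) ⊎ ends G e ≡ (v , u)

pairs : (n : ℕ) → List (Fin n × Fin n)
pairs n = filter (λ p → proj₁ p <? proj₂ p) (cartesianProduct (allFin n) (allFin n))

K : ℕ → Graph
K n = record { order = n ; size = length (pairs n) ; ends = lookup (pairs n) }

record Subgraph (G : Graph) : Set where
  field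
    vertices : Subset (order G)
    edges    : Subset (size G)
    closed   : ∀ {e} → e ∈ edges →
               proj₁ (ends G e) ∈ vertices × proj₂ (ends G e) ∈ vertices

open Subgraph public

module _ {G : Graph} where

  _⊑_ : Subgraph G → Subgraph G → Set
  S ⊑ T = vertices S ⊆ vertices T × edges S ⊆ edges T

  Adjacent : Subgraph G → V G → V G → Set
  Adjacent S u v = ∃ λ e → e ∈ edges S × Joins G e u v

  Connected : Subgraph G → Set
  Connected S = ∀ {u v} → u ∈ vertices S → v ∈ vertices S → Star (Adjacent S) u v

  NonemptyConnected : Subgraph G → Set
  NonemptyConnected S = Nonempty (vertices S) × Connected S

  Disjoint : Subgraph G → Subgraph G → Set
  Disjoint S T = ∀ {v} → v ∈ vertices S → v ∉ vertices T

  record IsComponent (C S : Subgraph G) : Set where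
    field
      inside            : C ⊑ S
      nonemptyConnected : NonemptyConnected C
      maximal           : ∀ (D : Subgraph G) → NonemptyConnected D →
                          D ⊑ S → C ⊑ D → D ⊑ C

private
  ∧-true : ∀ {a b} → a ∧ b ≡ true → a ≡ true × b ≡ true
  ∧-true {true} {true} _ = refl , refl

induced : (G : Graph) → Subset (order G) → Subgraph G
induced G X = record { vertices = X ; edges = tabulate both ; closed = closed′ }
  where
  both : E G → Bool
  both e = Vec.lookup X (proj₁ (ends G e)) ∧ Vec.lookup X (proj₂ (ends G e))

  closed′ : ∀ {e} → e ∈ tabulate both → proj₁ (ends G e) ∈ X × proj₂ (ends G e) ∈ X
  closed′ {e} e∈ with ∧-true (trans (sym (lookup∘tabulate both e)) ([]=⇒lookup e∈))
  ... | p , q = lookup⇒[]= _ X p , lookup⇒[]= _ X q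

record Minor (H G : Graph) : Set where
  field
    branch         : V H → Subgraph G
    edge           : E H → E G
    connected      : ∀ h → NonemptyConnected (branch h)
    disjoint       : ∀ {h₁ h₂} → h₁ ≢ h₂ → Disjoint (branch h₁) (branch h₂)
    edge-joins     : ∀ {e h₁ h₂} → Joins H e h₁ h₂ →
                     ∃₂ λ u v → Joins G (edge e) u v ×
                                u ∈ vertices (branch h₁) × v ∈ vertices (branch h₂)
    loop-outside   : ∀ {e h} → Joins H e h h → edge e ∉ edges (branch h)
    edge-injective : Injective _≡_ _≡_ edge

-- Not required to be proper.
Coloring : Graph → ℕ → Set
Coloring G k = V G → Fin k

ProperOn : {G : Graph} {k : ℕ} → Coloring G k → Subgraph G → Set
ProperOn {G} c S = ∀ {e u v} → e ∈ edges S → Joins G e u v → c u ≢ c v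

-- The 2-coloring is a total function on V G, but only its values on the union
-- of the branch subgraphs are constrained: the ends of each edge e lie there
-- by edge-joins.
IsOdd : {H G : Graph} → Minor H G → Set
IsOdd {H} {G} α = ∃ λ (c : Coloring G 2) →
    (∀ h → ProperOn c (branch h))
  × (∀ {e u v} → Joins G (edge e) u v → c u ≡ c v)
  where open Minor α

HasOddMinor : Graph → Graph → Set
HasOddMinor H G = ∃ λ (α : Minor H G) → IsOdd α

colorClass : (G : Graph) {k : ℕ} → Coloring G k → Fin k → Subset (order G)
colorClass G c i = tabulate (λ v → does (c v ≟ i))

IsMonochromaticComponent : {G : Graph} {k : ℕ} → Coloring G k → Subgraph G → Set
IsMonochromaticComponent {G} c C = ∃ λ i → IsComponent C (induced G (colorClass G c i))

HasClustering : {G : Graph} {k : ℕ} → Coloring G k → ℕ → Set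
HasClustering {G} c η =
  ∀ (C : Subgraph G) → IsMonochromaticComponent c C → ∣ vertices C ∣ ≤ η

ColorableWithClustering : Graph → ℕ → ℕ → Set
ColorableWithClustering G k η = ∃ λ (c : Coloring G k) → HasClustering {G} c η

{-# OPTIONS --safe #-}
module Submission where

-- Partition the vertices greedily into pieces, each with a palette out of s + 1 and a
-- 2-coloring for which the bichromatic edges connect the piece; a vertex is colored by its
-- palette and its 2-color. Any two pieces touching the same component C of the unlabelled
-- part are kept joined by a monochromatic edge (in the 2-coloring) and have distinct palettes,
-- so s + 1 pieces touching C would form an odd K_{s+1}-minor and some palette is free for C.
--
-- While an unlabelled vertex sees only one color in some piece, it joins that piece with the
-- other color and creates no new conflict. Afterwards every unlabelled vertex sees both colors
-- of each piece it is adjacent to. Then a new piece is opened in C: the union of paths of a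
-- breadth-first search tree of C to one neighbor of each touched piece, 2-colored by the parity
-- of the depth. It has a monochromatic edge to each of these pieces, whatever their colors are.
-- Adjacent vertices of equal parity lie in the same layer, and a layer contains at most one
-- vertex of each path, so the monochromatic components have at most s + 1 vertices. The
-- 2(s + 1) colors used are at most 8s - 4.

open import Data.Bool.Base using (Bool; true; false; not; if_then_else_)
open import Data.Bool.Properties using (not-¬; ¬-not)
import Data.Bool.Properties as Bool
open import Data.Fin.Base using (Fin; zero; suc; combine; inject≤)
import Data.Fin.Base as Fin
open import Data.Fin.Properties
  using (_≟_; _<?_; any?; all?; ¬∀⟶∃¬; 2↔Bool; combine-injective; inject≤-injective)
import Data.Fin.Properties as Fin
open import Data.Fin.Subset
  using (Subset; inside; outside; _∈_; _∉_; _⊆_; ∣_∣; Nonempty; Empty; ⊥; ⊤; ⁅_⁆; _∪_; _∩_; ∁)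
open import Data.Fin.Subset.Properties
open import Data.List.Base using (List; lookup; allFin; cartesianProduct)
open import Data.List.Membership.Propositional.Properties using (∈-lookup; ∈-filter⁻)
import Data.List.Relation.Unary.All as All
open import Data.List.Relation.Unary.AllPairs using (_∷_)
open import Data.List.Relation.Unary.Unique.Propositional using (Unique)
open import Data.List.Relation.Unary.Unique.Propositional.Properties
  using (filter⁺; cartesianProduct⁺; allFin⁺)
open import Data.Nat using (ℕ; zero; suc; pred; _+_; _*_; _∸_; _≤_; _<_; _≥_; z≤n; s≤s)
open import Data.Nat.GeneralisedArithmetic using (fold)
open import Data.Nat.Induction using (<-wellFounded)
open import Data.Nat.Properties
  using ( ≤-refl; ≤-trans; ≤-antisym; ≤-reflexive; n≤1+n; m≤m+n; <⇒≱; ≮⇒≥; m≤n⇒m<n∨m≡n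
        ; +-suc; +-monoʳ-≤; m∸n≤m; n∸n≡0; pred[m∸n]≡m∸[1+n]; +-∸-assoc
        ; *-suc; *-comm; *-monoˡ-≤; module ≤-Reasoning)
open import Data.Product using (∃; ∃₂; _×_; _,_; proj₁; proj₂; swap)
open import Data.Product.Properties using (,-injective; ≡-dec)
open import Data.Sum using (_⊎_; inj₁; inj₂; [_,_]′)
open import Data.Vec.Base using (_∷_; tabulate; _[_]≔_)
open import Data.Vec.Properties
  using (lookup∘tabulate; []=⇒lookup; lookup⇒[]=; []≔-updates; []≔-minimal)
open import Function.Base using (_∘_; id; const)
open import Function.Bundles using (Inverse)
open import Induction.WellFounded using (Acc; acc)
open import Relation.Binary.Construct.Closure.ReflexiveTransitive using (Star; ε; _◅_; _◅◅_)
import Relation.Binary.Construct.Closure.ReflexiveTransitive as Star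
open import Relation.Binary.PropositionalEquality
  using (_≡_; _≢_; refl; sym; trans; cong; cong₂; subst; subst₂; module ≡-Reasoning)
open import Relation.Nullary using (¬_; Dec; yes; no; does; contradiction)
open import Relation.Nullary.Decidable
  using (dec-true; dec-false; ¬?; _×-dec_; _⊎-dec_; decidable-stable)
open import Defs

-- Finite subsets, images and parity

module _ {n : ℕ} {P : Fin n → Set} (P? : ∀ x → Dec (P x)) where

  comprehension : Subset n
  comprehension = tabulate (does ∘ P?)

  ∈-comprehension⁺ : ∀ {x} → P x → x ∈ comprehension
  ∈-comprehension⁺ {x} px =
    lookup⇒[]= x _ (trans (lookup∘tabulate _ x) (dec-true (P? x) px))

  ∈-comprehension⁻ : ∀ {x} → x ∈ comprehension → P x
  ∈-comprehension⁻ {x} x∈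
    with P? x | trans (sym (lookup∘tabulate (does ∘ P?) x)) ([]=⇒lookup x∈)
  ... | yes px | _ = px
  ... | no _ | ()

∣p[x]≔inside∣≤1+∣p∣ : ∀ {n} (p : Subset n) x → ∣ p [ x ]≔ inside ∣ ≤ suc ∣ p ∣
∣p[x]≔inside∣≤1+∣p∣ (s ∷ p) zero = s≤s (∣p∣≤∣x∷p∣ s p)
∣p[x]≔inside∣≤1+∣p∣ (inside ∷ p) (suc x) = s≤s (∣p[x]≔inside∣≤1+∣p∣ p x)
∣p[x]≔inside∣≤1+∣p∣ (outside ∷ p) (suc x) = ∣p[x]≔inside∣≤1+∣p∣ p x

image : ∀ {k n} → (Fin k → Fin n) → Subset n
image {zero} f = ⊥
image {suc k} f = image (f ∘ suc) [ f zero ]≔ inside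

∈-image : ∀ {k n} (f : Fin k → Fin n) i → f i ∈ image f
∈-image f zero = []≔-updates (image (f ∘ suc)) (f zero)
∈-image f (suc i) with f (suc i) ≟ f zero
... | yes eq = subst (_∈ image f) (sym eq) (∈-image f zero)
... | no neq = []≔-minimal (image (f ∘ suc)) (f (suc i)) (f zero) neq (∈-image (f ∘ suc) i)

∣image∣≤ : ∀ {k n} (f : Fin k → Fin n) → ∣ image f ∣ ≤ k
∣image∣≤ {zero} {n} f = ≤-reflexive (∣⊥∣≡0 n)
∣image∣≤ {suc k} f =
  ≤-trans (∣p[x]≔inside∣≤1+∣p∣ (image (f ∘ suc)) (f zero)) (s≤s (∣image∣≤ (f ∘ suc)))

parity : ℕ → Bool
parity zero = false
parity (suc m) = not (parity m)

parity-close : ∀ {a b} → a ≤ suc b → b ≤ suc a → parity a ≡ parity b → a ≡ b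
parity-close {a} {b} a≤ b≤ eq with m≤n⇒m<n∨m≡n a≤
... | inj₂ refl = contradiction (sym eq) (not-¬ refl)
... | inj₁ (s≤s a≤b) with m≤n⇒m<n∨m≡n b≤
...   | inj₂ refl = contradiction eq (not-¬ refl)
...   | inj₁ (s≤s b≤a) = ≤-antisym a≤b b≤a

-- Breadth-first search for a symmetric relation

module SymmetricRelation {n : ℕ}
  (_~_ : Fin n → Fin n → Set)
  (~-sym : ∀ {x y} → x ~ y → y ~ x)
  (_~?_ : ∀ x y → Dec (x ~ y)) where

  Step : Subset n → Fin n → Fin n → Set
  Step U x y = x ∈ U × y ∈ U × x ~ y

  Reach : Subset n → Fin n → Fin n → Set
  Reach U = Star (Step U)

  record BFS (U : Subset n) (r : Fin n) : Set where
    field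
      component      : Subset n
      depth          : Fin n → ℕ
      parent         : Fin n → Fin n
      ⊆U             : component ⊆ U
      root∈          : r ∈ component
      component-step : ∀ {x y} → x ∈ component → y ∈ U → x ~ y → y ∈ component
      reachable      : ∀ {x} → x ∈ component → Reach U r x
      depth-root     : depth r ≡ 0
      depth-zero     : ∀ {x} → x ∈ component → depth x ≡ 0 → x ≡ r
      depth-adjacent : ∀ {x y} → x ∈ component → y ∈ U → x ~ y → depth y ≤ suc (depth x)
      parent∈        : ∀ {x} → x ∈ component → parent x ∈ component
      -- `pred` makes the root, of depth 0, its own parent. So `ancestor` may be iterated past the
      -- root, matching truncated subtraction in `depth-ancestor`.
      depth-parent   : ∀ {x} → x ∈ component → depth (parent x) ≡ pred (depth x)
      parent-adj     : ∀ {x} → x ∈ component → x ≢ r → x ~ parent x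

    component-reach : ∀ {x y} → x ∈ component → Reach U x y → y ∈ component
    component-reach x∈ ε = x∈
    component-reach x∈ ((_ , y∈U , x~y) ◅ p) = component-reach (component-step x∈ y∈U x~y) p

    ancestor : ℕ → Fin n → Fin n
    ancestor j x = fold x parent j

    ancestor∈ : ∀ j {x} → x ∈ component → ancestor j x ∈ component
    ancestor∈ zero x∈ = x∈
    ancestor∈ (suc j) x∈ = parent∈ (ancestor∈ j x∈)

    depth-ancestor : ∀ j {x} → x ∈ component → depth (ancestor j x) ≡ depth x ∸ j
    depth-ancestor zero x∈ = refl
    depth-ancestor (suc j) {x} x∈ =
      trans (depth-parent (ancestor∈ j x∈))
        (trans (cong pred (depth-ancestor j x∈)) (pred[m∸n]≡m∸[1+n] (depth x) j))

  module Balls (U : Subset n) (r : Fin n) (r∈U : r ∈ U) where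

    next? : ∀ S y → Dec (y ∈ U × ∃ λ x → x ∈ S × x ~ y)
    next? S y = (y ∈? U) ×-dec any? (λ x → (x ∈? S) ×-dec (x ~? y))

    ball : ℕ → Subset n
    ball zero = ⁅ r ⁆
    ball (suc m) = ball m ∪ comprehension (next? (ball m))

    ball-suc : ∀ m → ball m ⊆ ball (suc m)
    ball-suc m = p⊆p∪q _

    ball-mono : ∀ {l m} → l ≤ m → ball l ⊆ ball m
    ball-mono {m = zero} z≤n = id
    ball-mono {m = suc m} l≤ with m≤n⇒m<n∨m≡n l≤
    ... | inj₁ (s≤s l≤m) = ball-suc m ∘ ball-mono l≤m
    ... | inj₂ refl = id

    ball-next : ∀ m {x y} → x ∈ ball m → y ∈ U → x ~ y → y ∈ ball (suc m)
    ball-next m x∈ y∈U x~y =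
      q⊆p∪q (ball m) _ (∈-comprehension⁺ (next? (ball m)) (y∈U , _ , x∈ , x~y))

    ball-prev : ∀ m {y} → y ∈ ball (suc m) →
                y ∈ ball m ⊎ y ∈ U × ∃ λ x → x ∈ ball m × x ~ y
    ball-prev m y∈ with x∈p∪q⁻ (ball m) _ y∈
    ... | inj₁ y∈m = inj₁ y∈m
    ... | inj₂ y∈n = inj₂ (∈-comprehension⁻ (next? (ball m)) y∈n)

    ball⊆U : ∀ m → ball m ⊆ U
    ball⊆U zero x∈ rewrite x∈⁅y⁆⇒x≡y r x∈ = r∈U
    ball⊆U (suc m) x∈ = [ ball⊆U m , proj₁ ]′ (ball-prev m x∈)

    ball-reach : ∀ m {x} → x ∈ ball m → Reach U r x
    ball-reach zero x∈ rewrite x∈⁅y⁆⇒x≡y r x∈ = ε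
    ball-reach (suc m) x∈ with ball-prev m x∈
    ... | inj₁ x∈m = ball-reach m x∈m
    ... | inj₂ (x∈U , y , y∈m , y~x) = ball-reach m y∈m ◅◅ (ball⊆U m y∈m , x∈U , y~x) ◅ ε

    -- A ball that still grows gains a vertex, so one unit of fuel is traded for cardinality and the
    -- bound persists; without fuel it would contradict that a subset of `Fin n` has at most `n`
    -- elements.
    stabilises : ∀ fuel m → n < fuel + ∣ ball m ∣ → ∃ λ l → ball (suc l) ⊆ ball l
    stabilises zero m n< = contradiction (∣p∣≤n (ball m)) (<⇒≱ n<)
    stabilises (suc fuel) m n< with ball m ⊂? ball (suc m)
    ... | yes ⊂ = stabilises fuel (suc m)
          (≤-trans (≤-trans n< (≤-reflexive (sym (+-suc fuel _)))) (+-monoʳ-≤ fuel (p⊂q⇒∣p∣<∣q∣ ⊂)))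
    ... | no ⊄ = m , λ {x} x∈ → decidable-stable (x ∈? ball m) (λ x∉ → ⊄ (ball-suc m , x , x∈ , x∉))

    -- The index is chosen before membership is known and only its properties are conditional. This
    -- makes `depth` a total function, meaningful on the component alone.
    first-ball : ∀ m x → ∃ λ d → x ∈ ball m →
                 (d ≤ m) × (∀ {i} → x ∈ ball i → d ≤ i) × x ∈ ball d
    first-ball zero x = 0 , λ x∈ → z≤n , (λ _ → z≤n) , x∈
    first-ball (suc m) x with x ∈? ball m
    ... | yes x∈m = let d , spec = first-ball m x in
          d , λ _ → let d≤ , least , x∈d = spec x∈m in ≤-trans d≤ (n≤1+n m) , least , x∈d
    ... | no x∉m = suc m , λ x∈ →
          ≤-refl , (λ x∈i → ≮⇒≥ λ { (s≤s i≤m) → x∉m (ball-mono i≤m x∈i) }) , x∈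

    stable : ∃ λ l → ball (suc l) ⊆ ball l
    stable = stabilises (suc n) 0 (m≤m+n (suc n) _)

    radius : ℕ
    radius = proj₁ stable

    depth : Fin n → ℕ
    depth x = proj₁ (first-ball radius x)

    depth≤radius : ∀ {x} → x ∈ ball radius → depth x ≤ radius
    depth≤radius {x} x∈ = proj₁ (proj₂ (first-ball radius x) x∈)

    ∈ball-depth : ∀ {x} → x ∈ ball radius → x ∈ ball (depth x)
    ∈ball-depth {x} x∈ = proj₂ (proj₂ (proj₂ (first-ball radius x) x∈))

    component-step : ∀ {x y} → x ∈ ball radius → y ∈ U → x ~ y → y ∈ ball radius
    component-step x∈ y∈U x~y = proj₂ stable (ball-next radius x∈ y∈U x~y)

    depth-least : ∀ {x i} → x ∈ ball radius → x ∈ ball i → depth x ≤ i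
    depth-least {x} x∈ = proj₁ (proj₂ (proj₂ (first-ball radius x) x∈))

    depth-adjacent : ∀ {x y} → x ∈ ball radius → y ∈ U → x ~ y → depth y ≤ suc (depth x)
    depth-adjacent {x} x∈ y∈U x~y =
      depth-least (component-step x∈ y∈U x~y) (ball-next (depth x) (∈ball-depth x∈) y∈U x~y)

    depth-zero : ∀ {x} → x ∈ ball radius → depth x ≡ 0 → x ≡ r
    depth-zero {x} x∈ eq = x∈⁅y⁆⇒x≡y r (subst (λ d → x ∈ ball d) eq (∈ball-depth x∈))

    root∈ : r ∈ ball radius
    root∈ = ball-mono {m = radius} z≤n (x∈⁅x⁆ r)

    depth-root : depth r ≡ 0
    depth-root = ≤-antisym (depth-least root∈ (x∈⁅x⁆ r)) z≤n

    IsParent : Fin n → Fin n → Set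
    IsParent x y = y ∈ ball radius × depth y ≡ pred (depth x) × (x ≢ r → x ~ y)

    -- By minimality of its depth, `x` is not yet in `ball m`, so it entered through a neighbor
    -- there. That neighbor has depth exactly `m`: anything smaller would bring `x` closer to the
    -- root by `depth-adjacent`.
    predecessor : ∀ {x m} → x ∈ ball radius → depth x ≡ suc m → ∃ (IsParent x)
    predecessor {x} {m} x∈ eq with ball-prev m (subst (λ d → x ∈ ball d) eq (∈ball-depth x∈))
    ... | inj₁ x∈m = contradiction (depth-least x∈ x∈m) (<⇒≱ (≤-reflexive (sym eq)))
    ... | inj₂ (x∈U , y , y∈m , y~x) =
      y , y∈ , trans (≤-antisym (depth-least y∈ y∈m) m≤) (cong pred (sym eq)) , λ _ → ~-sym y~x
      where
      y∈ : y ∈ ball radius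
      y∈ = ball-mono (≤-trans (n≤1+n m) (≤-trans (≤-reflexive (sym eq)) (depth≤radius x∈))) y∈m
      m≤ : m ≤ depth y
      m≤ with s≤s m≤d ← ≤-trans (≤-reflexive (sym eq)) (depth-adjacent y∈ x∈U y~x) = m≤d

    parent-exists : ∀ x → ∃ λ y → x ∈ ball radius → IsParent x y
    parent-exists x with x ∈? ball radius
    ... | no x∉ = x , λ x∈ → contradiction x∈ x∉
    ... | yes x∈ with depth x in eq
    ...   | zero = x , λ _ → x∈ , eq , λ x≢r → contradiction (depth-zero x∈ eq) x≢r
    ...   | suc m = let y , spec = predecessor x∈ eq in
            y , λ _ → proj₁ spec , trans (proj₁ (proj₂ spec)) (cong pred eq) , proj₂ (proj₂ spec)

    bfs : BFS U r
    bfs = record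
      { component = ball radius
      ; depth = depth
      ; parent = λ x → proj₁ (parent-exists x)
      ; ⊆U = ball⊆U radius
      ; root∈ = root∈
      ; component-step = component-step
      ; reachable = ball-reach radius
      ; depth-root = depth-root
      ; depth-zero = depth-zero
      ; depth-adjacent = depth-adjacent
      ; parent∈ = λ {x} x∈ → proj₁ (proj₂ (parent-exists x) x∈)
      ; depth-parent = λ {x} x∈ → proj₁ (proj₂ (proj₂ (parent-exists x) x∈))
      ; parent-adj = λ {x} x∈ → proj₂ (proj₂ (proj₂ (parent-exists x) x∈))
      }

  -- Odd cliques, labelled pieces and the invariant

  record OddClique (k : ℕ) : Set where
    field
      block     : Fin k → Subset n
      side      : Fin n → Bool
      nonempty  : ∀ h → Nonempty (block h)
      -- Only bichromatic steps count, so the bichromatic edges inside a block can later serve as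
      -- the whole edge set of a branch subgraph.
      connected : ∀ {h x y} → x ∈ block h → y ∈ block h →
                  Star (λ a b → a ∈ block h × b ∈ block h × a ~ b × side a ≢ side b) x y
      disjoint  : ∀ {h h′ x} → x ∈ block h → x ∈ block h′ → h ≡ h′
      joined    : ∀ {h h′} → h ≢ h′ →
                  ∃₂ λ a b → a ∈ block h × b ∈ block h′ × a ~ b × side a ≡ side b

  module Pieces (k : ℕ) where

    -- cluster enumerates, with repetitions, a set containing the vertex and its
    -- monochromatic component.
    record Label : Set where
      field
        piece   : Fin n
        palette : Fin k
        color   : Bool
        cluster : Fin k → Fin n

    open Label

    Labelling : Set
    Labelling = Fin n → Label

    -- A piece is named by one of its vertices, whose label carries the palette of the piece.
    hue : Labelling → Fin n → Fin k
    hue ℓ x = palette (ℓ (piece (ℓ x)))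

    Link : Subset n → Labelling → Fin n → Fin n → Set
    Link U ℓ x y = x ∉ U × y ∉ U × x ~ y × piece (ℓ x) ≡ piece (ℓ y) × color (ℓ x) ≢ color (ℓ y)

    -- Components of `U` are represented by any of their vertices `x`, not as sets. When labelling
    -- splits a component, the invariants pass to its fragments because walks in the smaller set are
    -- walks in `U`.
    Touches : Subset n → Labelling → Fin n → Fin n → Set
    Touches U ℓ x i = ∃₂ λ y w → Reach U x y × y ∈ U × w ∉ U × y ~ w × piece (ℓ w) ≡ i

    MonoEdge : Subset n → Labelling → Fin n → Fin n → Set
    MonoEdge U ℓ i j = ∃₂ λ a b → a ∉ U × b ∉ U × piece (ℓ a) ≡ i × piece (ℓ b) ≡ j ×
                                  a ~ b × color (ℓ a) ≡ color (ℓ b)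

    MonoEdge-sym : ∀ {U ℓ i j} → MonoEdge U ℓ i j → MonoEdge U ℓ j i
    MonoEdge-sym (a , b , a∉ , b∉ , a∈i , b∈j , a~b , eq) =
      b , a , b∉ , a∉ , b∈j , a∈i , ~-sym a~b , sym eq

    -- U is the set of vertices not yet labelled; labels are meaningless on U.
    record State (U : Subset n) : Set where
      field
        label     : Labelling
        linked    : ∀ {x} → x ∉ U → Star (Link U label) x (piece (label x))
        -- Palettes may repeat among pieces that touch no common component. Around one component,
        -- however, the hue determines the piece.
        separated : ∀ {x i j} → Touches U label x i → Touches U label x j →
                    palette (label i) ≡ palette (label j) → i ≡ j
        joined    : ∀ {x i j} → Touches U label x i → Touches U label x j →
                    i ≢ j → MonoEdge U label i j
        covered   : ∀ {x} → x ∉ U → ∃ λ p → cluster (label x) p ≡ x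
        -- Equality of the enumerations themselves, so that it is transitive along any monochromatic
        -- walk.
        clustered : ∀ {x y} → x ∉ U → y ∉ U → x ~ y → hue label x ≡ hue label y →
                    color (label x) ≡ color (label y) → cluster (label x) ≡ cluster (label y)

      -- Links join labelled vertices only. Since the vertex naming a piece is thus labelled,
      -- extensions leave the palette of an old piece unchanged.
      piece∉ : ∀ {x} → x ∉ U → piece (label x) ∉ U
      piece∉ x∉ = end x∉ (linked x∉)
        where
        end : ∀ {x y} → x ∉ U → Star (Link U label) x y → y ∉ U
        end x∉ ε = x∉
        end _ ((_ , y∉ , _) ◅ p) = end y∉ p

    initial : Fin k → State ⊤
    initial p₀ = record
      { label = λ x → record { piece = x ; palette = p₀ ; color = true ; cluster = const x }
      ; linked = λ x∉ → contradiction ∈⊤ x∉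
      ; separated = λ (_ , _ , _ , _ , w∉ , _) → contradiction ∈⊤ w∉
      ; joined = λ (_ , _ , _ , _ , w∉ , _) → contradiction ∈⊤ w∉
      ; covered = λ x∉ → contradiction ∈⊤ x∉
      ; clustered = λ x∉ → contradiction ∈⊤ x∉
      }

    -- Extending a state; attaching a single vertex

    module Extension {U : Subset n} (S : State U) (H : Subset n) (new : Labelling) where
      open State S

      U′ : Subset n
      U′ = U ∩ ∁ H

      label′ : Labelling
      label′ x = if does (x ∈? H) then new x else label x

      U′⊆U : U′ ⊆ U
      U′⊆U = p∩q⊆p U (∁ H)

      new∉ : ∀ {x} → x ∈ H → x ∉ U′
      new∉ x∈H x∈U′ = x∈∁p⇒x∉p (p∩q⊆q U (∁ H) x∈U′) x∈H

      old∉ : ∀ {x} → x ∉ U → x ∉ U′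
      old∉ x∉U = x∉U ∘ U′⊆U

      new-or-old : ∀ {x} → x ∉ U′ → x ∈ H ⊎ x ∉ U
      new-or-old {x} x∉ with x ∈? H
      ... | yes x∈H = inj₁ x∈H
      ... | no x∉H = inj₂ λ x∈U → x∉ (x∈p∩q⁺ (x∈U , x∉p⇒x∈∁p x∉H))

      smaller : ∀ {x} → x ∈ U → x ∈ H → ∣ U′ ∣ < ∣ U ∣
      smaller x∈U x∈H = p⊂q⇒∣p∣<∣q∣ (U′⊆U , _ , x∈U , new∉ x∈H)

      label-new : ∀ {x} → x ∈ H → label′ x ≡ new x
      label-new {x} x∈H = cong (if_then new x else label x) (dec-true (x ∈? H) x∈H)

      module _ (H⊆U : H ⊆ U) where

        label-old : ∀ {x} → x ∉ U → label′ x ≡ label x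
        label-old {x} x∉U = cong (if_then new x else label x) (dec-false (x ∈? H) (x∉U ∘ H⊆U))

        palette-touched : ∀ {x i} → Touches U label x i → palette (label′ i) ≡ palette (label i)
        palette-touched (_ , _ , _ , _ , w∉ , _ , refl) = cong palette (label-old (piece∉ w∉))

        hue-new : ∀ {x} → x ∈ H → hue label′ x ≡ palette (label′ (piece (new x)))
        hue-new x∈H = cong (palette ∘ label′ ∘ piece) (label-new x∈H)

        hue-old : ∀ {x} → x ∉ U → hue label′ x ≡ hue label x
        hue-old x∉U = trans (cong (palette ∘ label′ ∘ piece) (label-old x∉U))
                            (cong palette (label-old (piece∉ x∉U)))

        link-old : ∀ {x y} → Link U label x y → Link U′ label′ x y
        link-old {x} {y} (x∉ , y∉ , x~y , eq , neq)
          rewrite label-old x∉ | label-old y∉ = old∉ x∉ , old∉ y∉ , x~y , eq , neq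

        mono-old : ∀ {i j} → MonoEdge U label i j → MonoEdge U′ label′ i j
        mono-old (a , b , a∉ , b∉ , a∈i , b∈j , a~b , eq) =
          a , b , old∉ a∉ , old∉ b∉ ,
          trans (cong piece (label-old a∉)) a∈i , trans (cong piece (label-old b∉)) b∈j , a~b ,
          trans (cong color (label-old a∉)) (trans eq (cong color (sym (label-old b∉))))

        reach-old : ∀ {x y} → Reach U′ x y → Reach U x y
        reach-old = Star.map λ (x∈ , y∈ , x~y) → U′⊆U x∈ , U′⊆U y∈ , x~y

        touch-old : ∀ {x i} → Touches U′ label′ x i →
                    Touches U label x i ⊎
                    ∃₂ λ y h → Reach U x y × y ∈ U × h ∈ H × y ~ h × piece (new h) ≡ i
        touch-old (y , w , x↝y , y∈ , w∉ , y~w , eq) with new-or-old w∉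
        ... | inj₁ w∈H = inj₂ (y , w , reach-old x↝y , U′⊆U y∈ , w∈H , y~w ,
                               trans (sym (cong piece (label-new w∈H))) eq)
        ... | inj₂ w∉U = inj₁ (y , w , reach-old x↝y , U′⊆U y∈ , w∉U , y~w ,
                               trans (sym (cong piece (label-old w∉U))) eq)

        -- The last hypothesis forbids monochromatic edges of equal hue between `H` and the vertices
        -- labelled before. Old clusters therefore stay as they are, and new clusters need checking
        -- inside `H` only.
        extend :
          (∀ {x} → x ∈ H → Star (Link U′ label′) x (piece (new x))) →
          (∀ {x i j} → Touches U′ label′ x i → Touches U′ label′ x j →
             palette (label′ i) ≡ palette (label′ j) → i ≡ j) →
          (∀ {x i j} → Touches U′ label′ x i → Touches U′ label′ x j →
             i ≢ j → MonoEdge U′ label′ i j) →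
          (∀ {x} → x ∈ H → ∃ λ p → cluster (new x) p ≡ x) →
          (∀ {x y} → x ∈ H → y ∈ H → x ~ y → color (new x) ≡ color (new y) →
             cluster (new x) ≡ cluster (new y)) →
          (∀ {x y} → x ∈ H → y ∉ U → x ~ y →
             palette (label′ (piece (new x))) ≡ hue label y →
             color (new x) ≢ color (label y)) →
          State U′
        extend linked-new separated′ joined′ covered-new clustered-new clash = record
          { label = label′
          ; linked = linked′
          ; separated = separated′
          ; joined = joined′
          ; covered = covered′
          ; clustered = clustered′
          }
          where
          linked′ : ∀ {x} → x ∉ U′ → Star (Link U′ label′) x (piece (label′ x))
          linked′ x∉ with new-or-old x∉
          ... | inj₁ x∈H = subst (Star _ _) (cong piece (sym (label-new x∈H))) (linked-new x∈H)
          ... | inj₂ x∉U = subst (Star _ _) (cong piece (sym (label-old x∉U)))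
                             (Star.map link-old (linked x∉U))

          covered′ : ∀ {x} → x ∉ U′ → ∃ λ p → cluster (label′ x) p ≡ x
          covered′ x∉ with new-or-old x∉
          ... | inj₁ x∈H rewrite label-new x∈H = covered-new x∈H
          ... | inj₂ x∉U rewrite label-old x∉U = covered x∉U

          clash′ : ∀ {x y} → x ∈ H → y ∉ U → x ~ y → hue label′ x ≡ hue label′ y →
                   color (label′ x) ≢ color (label′ y)
          clash′ x∈H y∉U x~y eq-hue eq-color =
            clash x∈H y∉U x~y
              (trans (sym (hue-new x∈H)) (trans eq-hue (hue-old y∉U)))
              (trans (sym (cong color (label-new x∈H)))
                (trans eq-color (cong color (label-old y∉U))))

          clustered′ : ∀ {x y} → x ∉ U′ → y ∉ U′ → x ~ y → hue label′ x ≡ hue label′ y →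
                       color (label′ x) ≡ color (label′ y) →
                       cluster (label′ x) ≡ cluster (label′ y)
          clustered′ x∉ y∉ x~y eq-hue eq-color with new-or-old x∉ | new-or-old y∉
          ... | inj₁ x∈H | inj₁ y∈H rewrite label-new x∈H | label-new y∈H =
            clustered-new x∈H y∈H x~y eq-color
          ... | inj₁ x∈H | inj₂ y∉U = contradiction eq-color (clash′ x∈H y∉U x~y eq-hue)
          ... | inj₂ x∉U | inj₁ y∈H =
            contradiction (sym eq-color) (clash′ y∈H x∉U (~-sym x~y) (sym eq-hue))
          ... | inj₂ x∉U | inj₂ y∉U =
            trans (cong cluster (label-old x∉U))
              (trans (clustered x∉U y∉U x~y
                       (trans (sym (hue-old x∉U)) (trans eq-hue (hue-old y∉U)))
                       (trans (sym (cong color (label-old x∉U)))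
                         (trans eq-color (cong color (label-old y∉U)))))
                (sym (cong cluster (label-old y∉U))))

    -- Adding v to the piece of w with the colour missing among its neighbours in that piece.
    module Attach {U : Subset n} (S : State U) {v w : Fin n}
      (v∈U : v ∈ U) (w∉U : w ∉ U) (v~w : v ~ w)
      (agree : ∀ {x} → x ∉ U → piece (State.label S x) ≡ piece (State.label S w) → v ~ x →
               color (State.label S x) ≡ color (State.label S w)) where
      open State S

      new : Labelling
      new _ = record { piece = piece (label w) ; palette = palette (label w)
                     ; color = not (color (label w)) ; cluster = λ _ → v }

      open Extension S ⁅ v ⁆ new public

      H⊆U : ⁅ v ⁆ ⊆ U
      H⊆U x∈ rewrite x∈⁅y⁆⇒x≡y v x∈ = v∈U

      -- A component next to `v` was joined to `v` inside `U`, and `v` already touched the piece of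
      -- `w`; so attaching creates no new contact.
      touch : ∀ {x i} → Touches U′ label′ x i → Touches U label x i
      touch t with touch-old H⊆U t
      ... | inj₁ t′ = t′
      ... | inj₂ (y , h , x↝y , y∈ , h∈ , y~h , refl) rewrite x∈⁅y⁆⇒x≡y v h∈ =
        v , w , x↝y ◅◅ (y∈ , v∈U , y~h) ◅ ε , v∈U , w∉U , v~w , refl

      attached : Fin k → State U′
      attached p₀ = extend H⊆U linked-new separated′ joined′ (λ x∈ → p₀ , sym (x∈⁅y⁆⇒x≡y v x∈))
                      (λ _ _ _ _ → refl) clash
        where
        linked-new : ∀ {x} → x ∈ ⁅ v ⁆ → Star (Link U′ label′) x (piece (label w))
        linked-new x∈ rewrite x∈⁅y⁆⇒x≡y v x∈ =
          (new∉ (x∈⁅x⁆ v) , old∉ w∉U , v~w ,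
           trans (cong piece (label-new (x∈⁅x⁆ v))) (cong piece (sym (label-old H⊆U w∉U))) ,
           λ eq → not-¬ refl (trans (sym (cong color (label-old H⊆U w∉U)))
                                (trans (sym eq) (cong color (label-new (x∈⁅x⁆ v)))))) ◅
          Star.map (link-old H⊆U) (linked w∉U)

        separated′ : ∀ {x i j} → Touches U′ label′ x i → Touches U′ label′ x j →
                     palette (label′ i) ≡ palette (label′ j) → i ≡ j
        separated′ t t′ eq =
          separated (touch t) (touch t′)
            (trans (sym (palette-touched H⊆U (touch t)))
              (trans eq (palette-touched H⊆U (touch t′))))

        joined′ : ∀ {x i j} → Touches U′ label′ x i → Touches U′ label′ x j →
                  i ≢ j → MonoEdge U′ label′ i j
        joined′ t t′ i≢j = mono-old H⊆U (joined (touch t) (touch t′) i≢j)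

        clash : ∀ {x y} → x ∈ ⁅ v ⁆ → y ∉ U → x ~ y →
                palette (label′ (piece (label w))) ≡ hue label y →
                not (color (label w)) ≢ color (label y)
        -- Before the step `v` touched both the piece of `y` and that of `w`, so equal hues force
        -- equal pieces by `separated`. Then `agree` gives `y` the color of `w`, which `v` avoids.
        clash {y = y} x∈ y∉ x~y eq-hue eq-color rewrite x∈⁅y⁆⇒x≡y v x∈ =
          not-¬ (agree y∉ same-piece x~y) (sym eq-color)
          where
          same-piece : piece (label y) ≡ piece (label w)
          same-piece = separated
            (v , y , ε , v∈U , y∉ , x~y , refl) (v , w , ε , v∈U , w∉U , v~w , refl)
            (sym (trans (cong palette (sym (label-old H⊆U (piece∉ w∉U)))) eq-hue))

    -- Opening a new piece in a saturated state

    Saturated : ∀ {U} → State U → Set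
    Saturated {U} S = ∀ {v w} → v ∈ U → w ∉ U → v ~ w → ∀ c →
      ∃ λ x → x ∉ U × piece (label x) ≡ piece (label w) × v ~ x × color (label x) ≡ c
      where open State S

    Meets : ∀ {U r} → State U → BFS U r → Fin k → Fin n → Set
    Meets {U} S B p y = y ∈ BFS.component B ×
      ∃ λ w → w ∉ U × y ~ w × hue (State.label S) w ≡ p

    meets? : ∀ {U r} (S : State U) (B : BFS U r) p y → Dec (Meets S B p y)
    meets? {U} S B p y = (y ∈? BFS.component B) ×-dec any? λ w →
      ¬? (w ∈? U) ×-dec ((y ~? w) ×-dec (hue (State.label S) w ≟ p))

    touches-root : ∀ {U r} (S : State U) (B : BFS U r) {p y} ((_ , w , _) : Meets S B p y) →
                   Touches U (State.label S) r (piece (State.label S w))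
    touches-root S B (y∈ , w , w∉ , y~w , _) =
      _ , w , BFS.reachable B y∈ , BFS.⊆U B y∈ , w∉ , y~w , refl

    module NewPiece {U : Subset n} {r : Fin n} (S : State U) (B : BFS U r)
      (sat : Saturated S) (p₀ q : Fin k) (q-free : ∀ y → ¬ Meets S B q y) where
      open State S
      open BFS B

      -- A palette that is not met gets the root as a harmless default, so that terminals and paths
      -- are indexed by all of `Fin k`.
      IsTerminal : Fin k → Fin n → Set
      IsTerminal p t = t ∈ component × (∃ (Meets S B p) → Meets S B p t)

      terminal-exists : ∀ p → ∃ (IsTerminal p)
      terminal-exists p with any? (meets? S B p)
      ... | yes (t , m) = t , proj₁ m , λ _ → m
      ... | no none = r , root∈ , λ m → contradiction m none

      terminal : Fin k → Fin n
      terminal p = proj₁ (terminal-exists p)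

      terminal∈ : ∀ p → terminal p ∈ component
      terminal∈ p = proj₁ (proj₂ (terminal-exists p))

      terminal-meets : ∀ p → ∃ (Meets S B p) → Meets S B p (terminal p)
      terminal-meets p = proj₂ (proj₂ (terminal-exists p))

      -- The vertex at depth `m` on the tree path from the root to `terminal p`. Beyond the end of
      -- the path, truncated subtraction returns the terminal.
      path : Fin k → ℕ → Fin n
      path p m = ancestor (depth (terminal p) ∸ m) (terminal p)

      path∈ : ∀ p m → path p m ∈ component
      path∈ p m = ancestor∈ (depth (terminal p) ∸ m) (terminal∈ p)

      depth-path : ∀ p m → depth (path p m) ≡ depth (terminal p) ∸ (depth (terminal p) ∸ m)
      depth-path p m = depth-ancestor (depth (terminal p) ∸ m) (terminal∈ p)

      -- Testing `x` only at its own depth shows that each layer of the core is enumerated by the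
      -- palettes; this enumeration becomes the `cluster` of the layer.
      core? : ∀ x → Dec (∃ λ p → path p (depth x) ≡ x)
      core? x = any? λ p → path p (depth x) ≟ x

      core : Subset n
      core = comprehension core?

      core⊆component : core ⊆ component
      core⊆component {x} x∈ with p , eq ← ∈-comprehension⁻ core? x∈ =
        subst (_∈ component) eq (path∈ p (depth x))

      core⊆U : core ⊆ U
      core⊆U = ⊆U ∘ core⊆component

      terminal∈core : ∀ p → terminal p ∈ core
      terminal∈core p = ∈-comprehension⁺ core?
        (p , cong (λ j → ancestor j (terminal p)) (n∸n≡0 (depth (terminal p))))

      root∈core : r ∈ core
      root∈core = ∈-comprehension⁺ core? (p₀ , trans (cong (path p₀) depth-root)
        (depth-zero (path∈ p₀ 0) (trans (depth-path p₀ 0) (n∸n≡0 (depth (terminal p₀))))))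

      depth-suc : ∀ {x} → x ∈ component → x ≢ r → depth x ≡ suc (depth (parent x))
      depth-suc {x} x∈ x≢r with depth x in eq | depth-parent x∈
      ... | zero | _ = contradiction (depth-zero x∈ eq) x≢r
      ... | suc m | eq′ = cong suc (sym eq′)

      parent∈core : ∀ {x} → x ∈ core → x ≢ r → parent x ∈ core
      parent∈core {x} x∈ x≢r with p , eq ← ∈-comprehension⁻ core? x∈ =
        ∈-comprehension⁺ core? (p , (begin
          ancestor (D ∸ d) t         ≡⟨ cong (λ j → ancestor j t) (suc-∸ d<D) ⟩
          parent (ancestor (D ∸ suc d) t) ≡⟨ cong (λ m → parent (path p m)) (sym dx) ⟩
          parent (path p (depth x))  ≡⟨ cong parent eq ⟩
          parent x                   ∎))
        where
        open ≡-Reasoning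
        t : Fin n
        t = terminal p
        D d : ℕ
        D = depth t
        d = depth (parent x)
        dx : depth x ≡ suc d
        dx = depth-suc (core⊆component x∈) x≢r
        -- Being on the path, `x` has depth `D ∸ (D ∸ depth x)`, hence at most `D`. Without this
        -- bound `D ∸ d` need not be a successor and the extra `parent` could not be split off.
        d<D : suc d ≤ D
        d<D = ≤-trans
          (≤-reflexive (trans (sym dx) (trans (cong depth (sym eq)) (depth-path p (depth x)))))
          (m∸n≤m D (D ∸ depth x))
        suc-∸ : ∀ {a b} → suc a ≤ b → b ∸ a ≡ suc (b ∸ suc a)
        suc-∸ (s≤s a≤b) = +-∸-assoc 1 a≤b

      new : Labelling
      new x = record { piece = r ; palette = q ; color = parity (depth x)
                     ; cluster = λ p → path p (depth x) }

      open Extension S core new public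

      hue-root : palette (label′ r) ≡ q
      hue-root = cong palette (label-new root∈core)

      linked-new : ∀ d {x} → depth x ≡ d → x ∈ core → Star (Link U′ label′) x r
      linked-new d {x} eq x∈ with x ≟ r
      ... | yes refl = ε
      linked-new zero eq x∈ | no x≢r = contradiction (depth-zero (core⊆component x∈) eq) x≢r
      linked-new (suc d) {x} eq x∈ | no x≢r =
        (new∉ x∈ , new∉ y∈ , parent-adj (core⊆component x∈) x≢r ,
         trans (cong piece (label-new x∈)) (cong piece (sym (label-new y∈))) , alternate) ◅
        linked-new d (trans (depth-parent (core⊆component x∈)) (cong pred eq)) y∈
        where
        y∈ : parent x ∈ core
        y∈ = parent∈core x∈ x≢r
        alternate : color (label′ x) ≢ color (label′ (parent x))
        alternate eq′ = not-¬ refl (trans (sym (cong color (label-new y∈))) (trans (sym eq′)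
          (trans (cong color (label-new x∈)) (cong parity (depth-suc (core⊆component x∈) x≢r)))))

      meets-touched : ∀ {x i} → x ∈ component → Touches U label x i →
                      ∃₂ λ y w → y ∈ component × w ∉ U × y ~ w × piece (label w) ≡ i
      meets-touched x∈ (y , w , x↝y , _ , w∉ , y~w , eq) =
        y , w , component-reach x∈ x↝y , w∉ , y~w , eq

      -- The core lies in one component of `U`, so only fragments of that component can see the new
      -- piece, named `r`.
      touch : ∀ {x i} → Touches U′ label′ x i → Touches U label x i ⊎ x ∈ component × i ≡ r
      touch t with touch-old core⊆U t
      ... | inj₁ t′ = inj₁ t′
      ... | inj₂ (y , h , x↝y , y∈ , h∈ , y~h , eq) = inj₂ (component-reach y∈C y↝x , sym eq)
        where
        y∈C = component-step (core⊆component h∈) y∈ (~-sym y~h)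
        y↝x = Star.reverse (λ (a∈ , b∈ , a~b) → b∈ , a∈ , ~-sym a~b) x↝y

      palette-fresh : ∀ {x i} → x ∈ component → Touches U label x i →
                      palette (label′ i) ≢ palette (label′ r)
      palette-fresh x∈ t eq with meets-touched x∈ t
      ... | y , w , y∈ , w∉ , y~w , refl = q-free y
        (y∈ , w , w∉ , y~w , trans (sym (palette-touched core⊆U t)) (trans eq hue-root))

      separated′ : ∀ {x i j} → Touches U′ label′ x i → Touches U′ label′ x j →
                   palette (label′ i) ≡ palette (label′ j) → i ≡ j
      separated′ t t′ eq with touch t | touch t′
      ... | inj₁ o | inj₁ o′ = separated o o′
              (trans (sym (palette-touched core⊆U o)) (trans eq (palette-touched core⊆U o′)))
      ... | inj₁ o | inj₂ (x∈ , refl) = contradiction eq (palette-fresh x∈ o)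
      ... | inj₂ (x∈ , refl) | inj₁ o′ = contradiction (sym eq) (palette-fresh x∈ o′)
      ... | inj₂ (_ , refl) | inj₂ (_ , refl) = refl

      -- The terminal for the hue of piece `i` is adjacent to some piece of that hue, which is `i`
      -- itself by `separated`. Saturation offers the terminal a neighbor there of either color, in
      -- particular of the color its depth dictates.
      mono-new : ∀ {x i} → x ∈ component → Touches U label x i → MonoEdge U′ label′ i r
      mono-new x∈ touches with meets-touched x∈ touches
      ... | y , w , y∈ , w∉ , y~w , refl
        with m@(t∈ , w′ , w′∉ , t~w′ , eq) ←
               terminal-meets (hue label w) (y , y∈ , w , w∉ , y~w , refl)
        with a , a∉ , a-piece , t~a , a-color ←
               sat (⊆U t∈) w′∉ t~w′ (parity (depth (terminal (hue label w)))) =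
        a , t , old∉ a∉ , new∉ t∈core ,
        trans (cong piece (label-old core⊆U a∉))
          (trans a-piece
            (separated (touches-root S B m) (touches-root S B (y∈ , w , w∉ , y~w , refl)) eq)) ,
        cong piece (label-new t∈core) , ~-sym t~a ,
        trans (cong color (label-old core⊆U a∉))
          (trans a-color (sym (cong color (label-new t∈core))))
        where
        t : Fin n
        t = terminal (hue label w)
        t∈core : t ∈ core
        t∈core = terminal∈core (hue label w)

      joined′ : ∀ {x i j} → Touches U′ label′ x i → Touches U′ label′ x j →
                i ≢ j → MonoEdge U′ label′ i j
      joined′ t t′ i≢j with touch t | touch t′
      ... | inj₁ o | inj₁ o′ = mono-old core⊆U (joined o o′ i≢j)
      ... | inj₁ o | inj₂ (x∈ , refl) = mono-new x∈ o
      ... | inj₂ (x∈ , refl) | inj₁ o′ = MonoEdge-sym {ℓ = label′} (mono-new x∈ o′)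
      ... | inj₂ (_ , refl) | inj₂ (_ , refl) = contradiction refl i≢j

      clustered-new : ∀ {x y} → x ∈ core → y ∈ core → x ~ y → parity (depth x) ≡ parity (depth y) →
                      cluster (new x) ≡ cluster (new y)
      clustered-new x∈ y∈ x~y eq = cong (λ d p → path p d)
        (parity-close (depth-adjacent (core⊆component y∈) (core⊆U x∈) (~-sym x~y))
                      (depth-adjacent (core⊆component x∈) (core⊆U y∈) x~y) eq)

      grown : State U′
      grown = extend core⊆U (linked-new _ refl) separated′ joined′ (∈-comprehension⁻ core?)
        clustered-new
        -- A labelled neighbor of the core with hue `q` would contradict the choice of `q`, whatever
        -- its color.
        λ x∈ y∉ x~y eq _ → q-free _
          (core⊆component x∈ , _ , y∉ , x~y , trans (sym eq) hue-root)

    -- An odd clique when every palette is met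

    module Saturation {U : Subset n} {r : Fin n} (S : State U) (B : BFS U r)
      (full : ∀ p → ∃ (Meets S B p)) where
      open State S

      contact : Fin k → Fin n
      contact p = proj₁ (proj₂ (proj₂ (full p)))

      center : Fin k → Fin n
      center p = piece (label (contact p))

      touches : ∀ p → Touches U label r (center p)
      touches p = touches-root S B (proj₂ (full p))

      -- The palette stored at the center of the chosen piece gives back `p`.
      center-injective : ∀ {p p′} → center p ≡ center p′ → p ≡ p′
      center-injective {p} {p′} eq = trans (sym (palette-center p))
        (trans (cong (palette ∘ label) eq) (palette-center p′))
        where
        palette-center : ∀ p → hue label (contact p) ≡ p
        palette-center p = proj₂ (proj₂ (proj₂ (proj₂ (proj₂ (full p)))))

      InBlock : Fin k → Fin n → Set
      InBlock p x = x ∉ U × piece (label x) ≡ center p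

      inBlock? : ∀ p x → Dec (InBlock p x)
      inBlock? p x = ¬? (x ∈? U) ×-dec (piece (label x) ≟ center p)

      block : Fin k → Subset n
      block p = comprehension (inBlock? p)

      ∈block : ∀ {p x} → x ∉ U → piece (label x) ≡ center p → x ∈ block p
      ∈block x∉ eq = ∈-comprehension⁺ (inBlock? _) (x∉ , eq)

      block⁻ : ∀ {p x} → x ∈ block p → InBlock p x
      block⁻ = ∈-comprehension⁻ (inBlock? _)

      BlockStep : Fin k → Fin n → Fin n → Set
      BlockStep p a b = a ∈ block p × b ∈ block p × a ~ b × color (label a) ≢ color (label b)

      in-block : ∀ {p x y} → x ∈ block p → Star (Link U label) x y → Star (BlockStep p) x y
      in-block x∈ ε = ε
      in-block x∈ ((_ , y∉ , x~y , eq , neq) ◅ l) = (x∈ , y∈ , x~y , neq) ◅ in-block y∈ l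
        where y∈ = ∈block y∉ (trans (sym eq) (proj₂ (block⁻ x∈)))

      -- Links never leave a piece, so the link walk from `x` to the vertex naming its piece stays
      -- in the block. Two such walks, one reversed, connect the block.
      to-center : ∀ {p x} → x ∈ block p → Star (BlockStep p) x (center p)
      to-center x∈ = subst (Star _ _) (proj₂ (block⁻ x∈)) (in-block x∈ (linked (proj₁ (block⁻ x∈))))

      oddClique : OddClique k
      oddClique = record
        { block = block
        ; side = color ∘ label
        ; nonempty = λ p → contact p , ∈block (proj₁ (proj₂ (proj₂ (proj₂ (full p))))) refl
        ; connected = λ x∈ y∈ → to-center x∈ ◅◅
            Star.reverse (λ (a∈ , b∈ , a~b , neq) → b∈ , a∈ , ~-sym a~b , neq ∘ sym) (to-center y∈)
        ; disjoint = λ x∈ x∈′ → center-injective (trans (sym (proj₂ (block⁻ x∈))) (proj₂ (block⁻ x∈′)))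
        ; joined = λ {p} {p′} p≢p′ →
            let a , b , a∉ , b∉ , a-piece , b-piece , a~b , eq =
                  joined (touches p) (touches p′) (p≢p′ ∘ center-injective)
            in a , b , ∈block a∉ a-piece , ∈block b∉ b-piece , a~b , eq
        }

    -- The greedy construction

    Blocked : ∀ {U} → State U → Fin n → Fin n → Set
    Blocked {U} S v w = ∃ λ x → x ∉ U × piece (label x) ≡ piece (label w) × v ~ x ×
                                color (label x) ≢ color (label w)
      where open State S

    blocked? : ∀ {U} (S : State U) v w → Dec (Blocked S v w)
    blocked? {U} S v w = any? λ x → ¬? (x ∈? U) ×-dec ((piece (label x) ≟ piece (label w)) ×-dec
      ((v ~? x) ×-dec ¬? (color (label x) Bool.≟ color (label w))))
      where open State S

    Attachable : ∀ {U} → State U → Fin n → Fin n → Set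
    Attachable {U} S v w = v ∈ U × w ∉ U × v ~ w × ¬ Blocked S v w

    attachable? : ∀ {U} (S : State U) v w → Dec (Attachable S v w)
    attachable? {U} S v w =
      (v ∈? U) ×-dec (¬? (w ∈? U) ×-dec ((v ~? w) ×-dec ¬? (blocked? S v w)))

    -- If `v` cannot be attached to the piece of `w`, some neighbor of `v` there differs in color
    -- from `w`; with only two colors, `w` and this neighbor show both.
    saturate : ∀ {U} (S : State U) → (∀ v w → ¬ Attachable S v w) → Saturated S
    saturate S none {v} {w} v∈ w∉ v~w c with color (State.label S w) Bool.≟ c
    ... | yes eq = w , w∉ , refl , v~w , eq
    ... | no neq
      with x , x∉ , same , v~x , neq′ ←
        decidable-stable (blocked? S v w) (λ ¬b → none v w (v∈ , w∉ , v~w , ¬b)) =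
      x , x∉ , same , v~x , trans (¬-not neq′) (sym (¬-not (neq ∘ sym)))

    Completion : Set
    Completion = OddClique k ⊎ ∃ λ U → Empty U × State U

    -- Every round labels `v` or the root `r`, so the size of `U` decreases. Attachment is tried
    -- first, which makes the state saturated whenever a new piece is opened.
    complete : Fin k → ∀ U → Acc _<_ ∣ U ∣ → State U → Completion
    complete p₀ U (acc rec) S with any? (λ v → any? (attachable? S v))
    ... | yes (v , w , v∈ , w∉ , v~w , free) =
      complete p₀ _ (rec (smaller v∈ (x∈⁅x⁆ v))) (attached p₀)
      where
      open Attach S v∈ w∉ v~w (λ {x} x∉ same v~x →
        decidable-stable (_ Bool.≟ _) (λ neq → free (x , x∉ , same , v~x , neq)))
    ... | no none with nonempty? U
    ...   | no empty = inj₂ (U , empty , S)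
    ...   | yes (r , r∈U) = explore (Balls.bfs U r r∈U)
      where
      explore : BFS U r → Completion
      explore B with all? (λ p → any? (meets? S B p))
      ... | yes full = inj₁ (Saturation.oddClique S B full)
      ... | no ¬full = complete p₀ _ (rec (smaller r∈U root∈core)) grown
        where
        unused = ¬∀⟶∃¬ k _ (λ p → any? (meets? S B p)) ¬full
        open NewPiece S B (saturate S λ v w a → none (v , w , a)) p₀ (proj₁ unused)
          (λ y m → proj₂ unused (y , m))

    completion : Fin k → Completion
    completion p₀ = complete p₀ ⊤ (<-wellFounded _) (initial p₀)

-- From odd cliques to odd minors of graphs

fromBool : Bool → Fin 2
fromBool = Inverse.from 2↔Bool

fromBool-injective : ∀ {a b} → fromBool a ≡ fromBool b → a ≡ b
fromBool-injective eq = trans (sym (strictlyInverseˡ _)) (trans (cong to eq) (strictlyInverseˡ _))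
  where open Inverse 2↔Bool

lookup-injective : ∀ {A : Set} {xs : List A} → Unique xs →
                   ∀ i j → lookup xs i ≡ lookup xs j → i ≡ j
lookup-injective (_ ∷ _) zero zero _ = refl
lookup-injective (x∉ ∷ _) zero (suc j) eq = contradiction eq (All.lookup x∉ (∈-lookup j))
lookup-injective (x∉ ∷ _) (suc i) zero eq = contradiction (sym eq) (All.lookup x∉ (∈-lookup i))
lookup-injective (_ ∷ u) (suc i) (suc j) eq = cong suc (lookup-injective u i j eq)

pairs-unique : ∀ k → Unique (pairs k)
pairs-unique k = filter⁺ _ (cartesianProduct⁺ (allFin⁺ k) (allFin⁺ k))

pairs-ordered : ∀ k e → proj₁ (lookup (pairs k) e) Fin.< proj₂ (lookup (pairs k) e)
pairs-ordered k e =
  proj₂ (∈-filter⁻ (λ p → proj₁ p <? proj₂ p)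
    {xs = cartesianProduct (allFin k) (allFin k)} (∈-lookup e))

module _ (G : Graph) where

  Joins-sym : ∀ {e u v} → Joins G e u v → Joins G e v u
  Joins-sym (inj₁ eq) = inj₂ eq
  Joins-sym (inj₂ eq) = inj₁ eq

  Joins-unique : ∀ {e u v a b} → Joins G e u v → Joins G e a b →
                 u ≡ a × v ≡ b ⊎ u ≡ b × v ≡ a
  Joins-unique (inj₁ p) (inj₁ q) = inj₁ (,-injective (trans (sym p) q))
  Joins-unique (inj₁ p) (inj₂ q) = inj₂ (,-injective (trans (sym p) q))
  Joins-unique (inj₂ p) (inj₁ q) = inj₂ (swap (,-injective (trans (sym p) q)))
  Joins-unique (inj₂ p) (inj₂ q) = inj₁ (swap (,-injective (trans (sym p) q)))

  _~_ : V G → V G → Set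
  u ~ v = ∃ λ e → Joins G e u v

  _~?_ : ∀ u v → Dec (u ~ v)
  u ~? v = any? λ e → ≡-dec _≟_ _≟_ (ends G e) (u , v) ⊎-dec ≡-dec _≟_ _≟_ (ends G e) (v , u)

  open SymmetricRelation _~_ (λ (e , j) → e , Joins-sym j) _~?_

  module _ {k : ℕ} (O : OddClique k) where
    open OddClique O

    -- Keeping only bichromatic edges makes the 2-coloring proper on each branch subgraph and
    -- discards loops.
    Crossing : Fin k → E G → Set
    Crossing h e = proj₁ (ends G e) ∈ block h × proj₂ (ends G e) ∈ block h ×
                   side (proj₁ (ends G e)) ≢ side (proj₂ (ends G e))

    crossing? : ∀ h e → Dec (Crossing h e)
    crossing? h e = (_ ∈? block h) ×-dec ((_ ∈? block h) ×-dec ¬? (_ Bool.≟ _))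

    crossing : ∀ {h e u v} → Joins G e u v → u ∈ block h → v ∈ block h →
               side u ≢ side v → Crossing h e
    crossing (inj₁ eq) u∈ v∈ neq rewrite eq = u∈ , v∈ , neq
    crossing (inj₂ eq) u∈ v∈ neq rewrite eq = v∈ , u∈ , neq ∘ sym

    branch : Fin k → Subgraph G
    branch h = record
      { vertices = block h
      ; edges = comprehension (crossing? h)
      ; closed = λ e∈ → let u∈ , v∈ , _ = ∈-comprehension⁻ (crossing? h) e∈ in u∈ , v∈
      }

    branch-proper : ∀ {h e u v} → e ∈ edges (branch h) → Joins G e u v → side u ≢ side v
    branch-proper {h} e∈ j with ∈-comprehension⁻ (crossing? h) e∈ | j
    ... | _ , _ , neq | inj₁ eq rewrite eq = neq
    ... | _ , _ , neq | inj₂ eq rewrite eq = neq ∘ sym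

    minor-edge : ∀ (e : E (K k)) → ∃₂ λ a b →
      a ∈ block (proj₁ (ends (K k) e)) × b ∈ block (proj₂ (ends (K k) e)) × a ~ b × side a ≡ side b
    minor-edge e = joined (Fin.<⇒≢ (pairs-ordered k e))

    edge : E (K k) → E G
    edge e = let _ , _ , _ , _ , (e′ , _) , _ = minor-edge e in e′

    edge-joins : ∀ {e h₁ h₂} → Joins (K k) e h₁ h₂ →
                 ∃₂ λ u v → Joins G (edge e) u v × u ∈ block h₁ × v ∈ block h₂
    edge-joins {e} j with minor-edge e | j
    ... | a , b , a∈ , b∈ , (_ , ab) , _ | inj₁ refl = a , b , ab , a∈ , b∈
    ... | a , b , a∈ , b∈ , (_ , ab) , _ | inj₂ refl = b , a , Joins-sym ab , b∈ , a∈

    edge-mono : ∀ {e u v} → Joins G (edge e) u v → side u ≡ side v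
    edge-mono {e} j with minor-edge e
    ... | a , b , _ , _ , (_ , ab) , eq with Joins-unique j ab
    ...   | inj₁ (refl , refl) = eq
    ...   | inj₂ (refl , refl) = sym eq

    -- Equal edges have the same ends, and disjoint blocks recover the indices from them. A match in
    -- reversed order is impossible because `pairs` lists increasing pairs only.
    edge-injective : ∀ {e f} → edge e ≡ edge f → e ≡ f
    edge-injective {e} {f} eq with minor-edge e | minor-edge f
    ... | a , b , a∈ , b∈ , (_ , ab) , _ | a′ , b′ , a′∈ , b′∈ , (_ , ab′) , _
      with refl ← eq | Joins-unique ab ab′
    ...   | inj₁ (refl , refl) = lookup-injective (pairs-unique k) e f
              (cong₂ _,_ (disjoint a∈ a′∈) (disjoint b∈ b′∈))
    ...   | inj₂ (refl , refl) = contradiction (pairs-ordered k f)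
              (Fin.<-asym (subst₂ Fin._<_ (disjoint a∈ b′∈) (disjoint b∈ a′∈) (pairs-ordered k e)))

    oddClique⇒oddMinor : HasOddMinor (K k) G
    oddClique⇒oddMinor =
      record
        { branch = branch
        ; edge = edge
        ; connected = λ h → nonempty h , λ u∈ v∈ → Star.map
            (λ (a∈ , b∈ , (e , j) , neq) → e , ∈-comprehension⁺ (crossing? h) (crossing j a∈ b∈ neq) , j)
            (connected u∈ v∈)
        ; disjoint = λ h₁≢h₂ v∈ v∈′ → h₁≢h₂ (disjoint v∈ v∈′)
        ; edge-joins = edge-joins
        -- Vacuous: increasing pairs have distinct entries, so the complete graph has no loops.
        ; loop-outside = λ {e} j _ → Fin.<⇒≢ (pairs-ordered k e) (loop j)
        ; edge-injective = edge-injective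
        } ,
      fromBool ∘ side ,
      (λ h e∈ j → branch-proper {h} e∈ j ∘ fromBool-injective) ,
      λ {e} j → cong fromBool (edge-mono {e} j)
      where
      loop : ∀ {p : Fin k × Fin k} {h} → p ≡ (h , h) ⊎ p ≡ (h , h) → proj₁ p ≡ proj₂ p
      loop (inj₁ refl) = refl
      loop (inj₂ refl) = refl

  -- From complete labellings to clustered colorings

  module _ {k m : ℕ} (2k≤m : k * 2 ≤ m) where
    open Pieces k

    -- All vertices of a monochromatic component share one `cluster` function, and each is a value
    -- of its own by `covered`; so the component lies in the image of a function on `Fin k`.
    state⇒coloring : ∀ {U} → Empty U → State U → ColorableWithClustering G m k
    state⇒coloring {U} empty S = coloring , clustering
      where
      open State S
      open Label

      vertex∉ : ∀ {x} → x ∉ U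
      vertex∉ x∈ = empty (_ , x∈)

      coloring : Coloring G m
      coloring x = inject≤ (combine (hue label x) (fromBool (color (label x)))) 2k≤m

      cluster-adjacent : ∀ {x y} → x ~ y → coloring x ≡ coloring y →
                         cluster (label x) ≡ cluster (label y)
      cluster-adjacent x~y eq =
        let eq-hue , eq-color = combine-injective _ _ _ _ (inject≤-injective 2k≤m 2k≤m _ _ eq)
        in clustered vertex∉ vertex∉ x~y eq-hue (fromBool-injective eq-color)

      clustering : HasClustering {G} coloring k
      clustering C (i , component) with IsComponent.nonemptyConnected component
      ... | (x , x∈) , C-connected =
        ≤-trans (p⊆q⇒∣p∣≤∣q∣ C⊆image) (∣image∣≤ (cluster (label x)))
        where
        monochromatic : ∀ {v} → v ∈ vertices C → coloring v ≡ i
        monochromatic v∈ =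
          ∈-comprehension⁻ (λ v → coloring v ≟ i) (proj₁ (IsComponent.inside component) v∈)

        ends∈ : ∀ {e u v} → e ∈ edges C → Joins G e u v → u ∈ vertices C × v ∈ vertices C
        ends∈ e∈ j with closed C e∈ | j
        ... | p | inj₁ eq rewrite eq = p
        ... | p | inj₂ eq rewrite eq = swap p

        cluster-constant : ∀ {u v} → Star (Adjacent C) u v → cluster (label u) ≡ cluster (label v)
        cluster-constant ε = refl
        cluster-constant ((e , e∈ , j) ◅ p) =
          let u∈ , w∈ = ends∈ e∈ j in
          trans (cluster-adjacent (e , j) (trans (monochromatic u∈) (sym (monochromatic w∈))))
            (cluster-constant p)

        C⊆image : vertices C ⊆ image (cluster (label x))
        C⊆image {v} v∈ =
          let p , eq = covered {v} vertex∉ in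
          subst (_∈ image (cluster (label x)))
            (trans (cong (λ f → f p) (cluster-constant (C-connected x∈ v∈))) eq)
            (∈-image (cluster (label x)) p)

  colorable : ∀ k {m} → suc k * 2 ≤ m → ¬ HasOddMinor (K (suc k)) G →
              ColorableWithClustering G m (suc k)
  -- With `suc k` palettes, `zero` can serve as the arbitrary initial palette.
  colorable k 2k≤m no-minor with Pieces.completion (suc k) zero
  ... | inj₁ clique = contradiction (oddClique⇒oddMinor clique) no-minor
  ... | inj₂ (U , empty , S) = state⇒coloring 2k≤m empty S

-- For `s` = 1 both sides are 4. For `s` = 0 truncation turns the right side into 0 and the bound
-- fails.
palettes-fit : ∀ {s} → s ≥ 1 → suc s * 2 ≤ 8 * s ∸ 4
palettes-fit {suc t} _ = begin
  4 + t * 2      ≡⟨ cong (4 +_) (*-comm t 2) ⟩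
  4 + 2 * t      ≤⟨ +-monoʳ-≤ 4 (*-monoˡ-≤ t {2} {8} (s≤s (s≤s z≤n))) ⟩
  8 + 8 * t ∸ 4  ≡⟨ cong (_∸ 4) (*-suc 8 t) ⟨
  8 * suc t ∸ 4  ∎
  where open ≤-Reasoning

theorem6 : ∀ (s : ℕ) → s ≥ 1 →
    ∃ λ (η : ℕ) → η ≥ 1 ×
    (∀ (G : Graph) → ¬ HasOddMinor (K (suc s)) G →
    ColorableWithClustering G (8 * s ∸ 4) η)
theorem6 s s≥1 = suc s , s≤s z≤n , λ G → colorable G s (palettes-fit s≥1)
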